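{- Let $D=(V,A)$ be a finite connected directed acyclic graph. Then $D$ has at least one topological additive numbering if and only if the following linear program, in the real variables $k$ and $f(v)$ ($v\in V$), is feasible: $$\min\ k \quad\text{subject to}\quad \sum_{w\in N(v)}f(w)-\sum_{w\in N(u)}f(w)\ge 1\ \ \forall (u,v)\in A;\qquad k-f(v)\ge 0\ \ \forall v\in V;\qquad f(v)\ge 1\ \ \forall v\in V.$$
   Context: For a directed acyclic graph $D=(V,A)$, $N(v)$ denotes the set of neighbors of $v$ in the undirected underlying graph of $D$ (both in- and out-neighbors). $\mathbb{N}$ denotes the positive integers. A labeling $f:V\to\mathbb{N}$ is a topological additive numbering of $D$ if, with $S(v)=\sum_{w\in N(v)}f(w)$, one has $S(u)<S(v)$ for every $(u,v)\in A$. -}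

module Defs where

open import Data.Fin using (Fin)
open import Data.List using (List; map; foldr; filter; allFin; sum)
open import Data.Nat as ℕ using (ℕ)
import Data.Nat.Properties as ℕ
open import Data.Product using (∃; _×_; _,_)
open import Data.Rational as ℚ using (ℚ; 0ℚ; 1ℚ; ½)
import Data.Rational.Properties as ℚ
open import Data.Rational.Solver using (module +-*-Solver)
open import Data.Sum using (_⊎_)
open import Level using (0ℓ)
open import Relation.Binary using (Rel; Decidable)
open import Relation.Binary.Construct.Closure.ReflexiveTransitive using (Star)
open import Relation.Binary.Construct.Closure.Transitive using (TransClosure)
open import Relation.Binary.PropositionalEquality using (_≡_; refl; sym; trans; cong; subst)
open import Relation.Nullary using (¬_)
open import Relation.Nullary.Decidable using (_⊎-dec_)

------------------------------------------------------------------------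
-- Real numbers

-- Cantor's construction: a real is represented by a Cauchy sequence of
-- rationals. No quotient is taken; the order _≤ᴿ_ is the order of the
-- limits, so it does not distinguish representatives of the same real.

IsCauchy : (ℕ → ℚ) → Set
IsCauchy x =
  ∀ ε → 0ℚ ℚ.< ε → ∃ λ N → ∀ m n → N ℕ.≤ m → N ℕ.≤ n → ℚ.∣ x m ℚ.- x n ∣ ℚ.< ε

record ℝ : Set where
  constructor mkℝ
  field
    seq    : ℕ → ℚ
    cauchy : IsCauchy seq

open ℝ public

private
  half-pos : ∀ {ε} → 0ℚ ℚ.< ε → 0ℚ ℚ.< ½ ℚ.* ε
  half-pos {ε} ε>0 = subst (ℚ._< ½ ℚ.* ε) (ℚ.*-zeroʳ ½) (ℚ.*-monoʳ-<-pos ½ ε>0)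

  half+half : ∀ ε → ½ ℚ.* ε ℚ.+ ½ ℚ.* ε ≡ ε
  half+half = solve 1 (λ e → con ½ :* e :+ con ½ :* e := e) refl
    where open +-*-Solver

  sum-of-differences : ∀ a b c d → (a ℚ.+ b) ℚ.- (c ℚ.+ d) ≡ (a ℚ.- c) ℚ.+ (b ℚ.- d)
  sum-of-differences =
    solve 4 (λ a b c d → (a :+ b) :+ :- (c :+ d) := (a :+ :- c) :+ (b :+ :- d)) refl
    where open +-*-Solver

fromℚ : ℚ → ℝ
fromℚ q = mkℝ (λ _ → q) λ ε ε>0 →
  0 , λ _ _ _ _ → subst (λ d → ℚ.∣ d ∣ ℚ.< ε) (sym (ℚ.+-inverseʳ q)) ε>0

0ᴿ 1ᴿ : ℝ
0ᴿ = fromℚ 0ℚ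
1ᴿ = fromℚ 1ℚ

infixl 6 _+ᴿ_ _-ᴿ_
infix  8 -ᴿ_
infix  4 _≤ᴿ_ _≥ᴿ_

_+ᴿ_ : ℝ → ℝ → ℝ
seq (x +ᴿ y) n = seq x n ℚ.+ seq y n
cauchy (x +ᴿ y) ε ε>0
  with M , p ← cauchy x (½ ℚ.* ε) (half-pos ε>0)
     | N , q ← cauchy y (½ ℚ.* ε) (half-pos ε>0)
  = M ℕ.⊔ N , λ m n ≤m ≤n → begin-strict
      ℚ.∣ (seq x m ℚ.+ seq y m) ℚ.- (seq x n ℚ.+ seq y n) ∣
        ≡⟨ cong ℚ.∣_∣ (sum-of-differences (seq x m) (seq y m) (seq x n) (seq y n)) ⟩
      ℚ.∣ (seq x m ℚ.- seq x n) ℚ.+ (seq y m ℚ.- seq y n) ∣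
        ≤⟨ ℚ.∣p+q∣≤∣p∣+∣q∣ (seq x m ℚ.- seq x n) (seq y m ℚ.- seq y n) ⟩
      ℚ.∣ seq x m ℚ.- seq x n ∣ ℚ.+ ℚ.∣ seq y m ℚ.- seq y n ∣
        <⟨ ℚ.+-mono-< (p m n (ℕ.m⊔n≤o⇒m≤o M N ≤m) (ℕ.m⊔n≤o⇒m≤o M N ≤n))
                      (q m n (ℕ.m⊔n≤o⇒n≤o M N ≤m) (ℕ.m⊔n≤o⇒n≤o M N ≤n)) ⟩
      ½ ℚ.* ε ℚ.+ ½ ℚ.* ε
        ≡⟨ half+half ε ⟩
      ε ∎
  where open ℚ.≤-Reasoning

-ᴿ_ : ℝ → ℝ
seq (-ᴿ x) n = ℚ.- seq x n
cauchy (-ᴿ x) ε ε>0 with N , p ← cauchy x ε ε>0 =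
  N , λ m n ≤m ≤n → subst (ℚ._< ε)
    (trans (sym (ℚ.∣-p∣≡∣p∣ (seq x m ℚ.- seq x n)))
           (cong ℚ.∣_∣ (ℚ.neg-distrib-+ (seq x m) (ℚ.- seq x n))))
    (p m n ≤m ≤n)

_-ᴿ_ : ℝ → ℝ → ℝ
x -ᴿ y = x +ᴿ (-ᴿ y)

_≤ᴿ_ : Rel ℝ 0ℓ
x ≤ᴿ y = ∀ ε → 0ℚ ℚ.< ε → ∃ λ N → ∀ n → N ℕ.≤ n → seq x n ℚ.≤ seq y n ℚ.+ ε

_≥ᴿ_ : Rel ℝ 0ℓ
x ≥ᴿ y = y ≤ᴿ x

sumᴿ : List ℝ → ℝ
sumᴿ = foldr _+ᴿ_ 0ᴿ

------------------------------------------------------------------------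
-- Directed acyclic graphs

record DAG : Set₁ where
  field
    order   : ℕ
  V : Set
  V = Fin order
  field
    _⟶_     : Rel V 0ℓ
    _⟶?_    : Decidable _⟶_
    acyclic : ∀ v → ¬ TransClosure _⟶_ v v

  Adjacent : Rel V 0ℓ
  Adjacent u v = u ⟶ v ⊎ v ⟶ u

  adjacent? : Decidable Adjacent
  adjacent? u v = (u ⟶? v) ⊎-dec (v ⟶? u)

  -- Each neighbour is listed exactly once, so sums over N v are sums over
  -- the set of neighbours.
  N : V → List V
  N v = filter (adjacent? v) (allFin order)

  Connected : Set
  Connected = ∀ u v → Star Adjacent u v

------------------------------------------------------------------------
-- Topological additive numberings

module _ (D : DAG) where
  open DAG D

  record IsTopologicalAdditiveNumbering (f : V → ℕ) : Set where
    S : V → ℕ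
    S v = sum (map f (N v))
    field
      positive   : ∀ v → f v ℕ.≥ 1
      increasing : ∀ {u v} → u ⟶ v → S u ℕ.< S v

------------------------------------------------------------------------
-- The linear program

record MinimizationProgram : Set₁ where
  field
    Point       : Set
    objective   : Point → ℝ
    Constraints : Point → Set

Feasible : MinimizationProgram → Set
Feasible P = ∃ Constraints
  where open MinimizationProgram P

module _ (D : DAG) where
  open DAG D

  record LPConstraints (k : ℝ) (f : V → ℝ) : Set where
    field
      arc-constraint   : ∀ {u v} → u ⟶ v →
                         sumᴿ (map f (N v)) -ᴿ sumᴿ (map f (N u)) ≥ᴿ 1ᴿ
      upper-constraint : ∀ v → k -ᴿ f v ≥ᴿ 0ᴿ
      lower-constraint : ∀ v → f v ≥ᴿ 1ᴿ

  numberingLP : MinimizationProgram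
  numberingLP = record
    { Point       = ℝ × (V → ℝ)
    ; objective   = λ (k , f) → k
    ; Constraints = λ (k , f) → LPConstraints k f
    }

{-# OPTIONS --safe #-}

-- If (k , f) is feasible then, in the Cauchy sequences representing f, some
-- single index m gives rationals that still satisfy f v > 0 and S u < S v for
-- the finitely many vertices and arcs. These strict inequalities
-- are homogeneous, so multiplying the rationals by a common denominator yields
-- a numbering.

module Submission where

open import Defs
open import Data.Fin using (Fin; zero; suc)
open import Data.Integer as ℤ using (+_)
import Data.Integer.Properties as ℤ
open import Data.List using ([]; _∷_; map; tabulate)
open import Data.List.Extrema.Nat using (max; xs≤max)
open import Data.List.Relation.Unary.All.Properties using (tabulate⁻)
open import Data.Nat as ℕ using (ℕ; suc)
open import Data.Nat.ListAction using (sum)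
import Data.Nat.Properties as ℕ
open import Data.Product using (∃; ∃₂; _,_; proj₁; proj₂)
open import Data.Rational as ℚ using (ℚ; mkℚ; 0ℚ; 1ℚ; ½)
open import Data.Rational.Literals using (fromℤ)
import Data.Rational.Properties as ℚ
open import Data.Rational.Unnormalised as ℚᵘ using (*≡*)
import Data.Rational.Unnormalised.Properties as ℚᵘ
open import Function.Base using (_∘_)
open import Function.Bundles using (_⇔_; mk⇔)
open import Relation.Binary.PropositionalEquality
  using (_≡_; refl; sym; trans; cong; cong₂; subst; subst₂; module ≡-Reasoning)
open import Relation.Nullary using (yes; no; contradiction)
open import Relation.Nullary.Decidable using (toWitness)

-- Going through `fromℤ` makes the denominator 1 by computation, so comparing two such rationals is
-- an integer comparison with factors `+ 1` on both sides.
fromℕ : ℕ → ℚ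
fromℕ n = fromℤ (+ n)

fromℕ-homo-+ : ∀ m n → fromℕ (m ℕ.+ n) ≡ fromℕ m ℚ.+ fromℕ n
fromℕ-homo-+ m n = ℚ.toℚᵘ-injective (ℚᵘ.≃-trans
  (*≡* (cong (ℤ._* + 1) (cong₂ ℤ._+_ (sym (ℤ.*-identityʳ (+ m))) (sym (ℤ.*-identityʳ (+ n))))))
  (ℚᵘ.≃-sym (ℚ.toℚᵘ-homo-+ (fromℕ m) (fromℕ n))))

fromℕ-homo-* : ∀ m n → fromℕ (m ℕ.* n) ≡ fromℕ m ℚ.* fromℕ n
fromℕ-homo-* m n = ℚ.toℚᵘ-injective (ℚᵘ.≃-trans
  (*≡* (cong (ℤ._* + 1) (ℤ.pos-* m n)))
  (ℚᵘ.≃-sym (ℚ.toℚᵘ-homo-* (fromℕ m) (fromℕ n))))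

fromℕ-mono-≤ : ∀ {m n} → m ℕ.≤ n → fromℕ m ℚ.≤ fromℕ n
fromℕ-mono-≤ m≤n = ℚ.*≤* (ℤ.*-monoʳ-≤-nonNeg (+ 1) (ℤ.+≤+ m≤n))

fromℕ-cancel-< : ∀ {m n} → fromℕ m ℚ.< fromℕ n → m ℕ.< n
fromℕ-cancel-< m<n = ℤ.drop‿+<+ (ℤ.*-cancelʳ-<-nonNeg (+ 1) (ℚ.drop-*<* m<n))

-- Nonnegativity makes the numerator equal to its absolute value, so clearing the denominator lands
-- in the naturals.
denominator-*-nonNeg : ∀ p .{{_ : ℚ.NonNegative p}} →
                       fromℕ (ℚ.denominatorℕ p) ℚ.* p ≡ fromℕ ℤ.∣ ℚ.numerator p ∣
denominator-*-nonNeg p@(mkℚ (+ n) d-1 _) = ℚ.toℚᵘ-injective (ℚᵘ.≃-trans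
  (ℚ.toℚᵘ-homo-* (fromℕ (suc d-1)) p)
  (*≡* (begin
    (+ suc d-1 ℤ.* + n) ℤ.* + 1  ≡⟨ ℤ.*-identityʳ _ ⟩
    + suc d-1 ℤ.* + n            ≡⟨ ℤ.*-comm (+ suc d-1) (+ n) ⟩
    + n ℤ.* + suc d-1            ≡⟨ cong (λ d → + n ℤ.* + d) (ℕ.*-identityˡ (suc d-1)) ⟨
    + n ℤ.* + (1 ℕ.* suc d-1)    ∎)))
  where open ≡-Reasoning

-- The product of all the denominators serves. It is returned as a predecessor, so that the
-- multiplier `suc d-1` is visibly positive.
commonDenominator : ∀ {n} (q : Fin n → ℚ) → (∀ i → ℚ.NonNegative (q i)) →
  ∃₂ λ d-1 (g : Fin n → ℕ) → ∀ i → fromℕ (g i) ≡ fromℕ (suc d-1) ℚ.* q i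
commonDenominator {ℕ.zero} q q≥0 = 0 , (λ ()) , λ ()
commonDenominator {suc n} q q≥0
  with e-1 , g , g≡eq ← commonDenominator (q ∘ suc) (q≥0 ∘ suc)
  -- Both `e` and `d` are successors, hence `suc (ℕ.pred (e ℕ.* d))` computes to `e ℕ.* d`.
  = ℕ.pred (e ℕ.* d) , g′ , λ where
      zero → begin
        fromℕ (e ℕ.* a)                  ≡⟨ fromℕ-homo-* e a ⟩
        fromℕ e ℚ.* fromℕ a              ≡⟨ cong (fromℕ e ℚ.*_) (denominator-*-nonNeg (q zero) {{q≥0 zero}}) ⟨
        fromℕ e ℚ.* (fromℕ d ℚ.* q zero) ≡⟨ ℚ.*-assoc (fromℕ e) (fromℕ d) (q zero) ⟨
        fromℕ e ℚ.* fromℕ d ℚ.* q zero   ≡⟨ cong (ℚ._* q zero) (fromℕ-homo-* e d) ⟨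
        fromℕ (e ℕ.* d) ℚ.* q zero       ∎
      (suc i) → begin
        fromℕ (d ℕ.* g i)                     ≡⟨ fromℕ-homo-* d (g i) ⟩
        fromℕ d ℚ.* fromℕ (g i)               ≡⟨ cong (fromℕ d ℚ.*_) (g≡eq i) ⟩
        fromℕ d ℚ.* (fromℕ e ℚ.* q (suc i))   ≡⟨ ℚ.*-assoc (fromℕ d) (fromℕ e) (q (suc i)) ⟨
        fromℕ d ℚ.* fromℕ e ℚ.* q (suc i)     ≡⟨ cong (ℚ._* q (suc i)) (fromℕ-homo-* d e) ⟨
        fromℕ (d ℕ.* e) ℚ.* q (suc i)         ≡⟨ cong (λ c → fromℕ c ℚ.* q (suc i)) (ℕ.*-comm d e) ⟩
        fromℕ (e ℕ.* d) ℚ.* q (suc i)         ∎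
  where
  open ≡-Reasoning
  d = ℚ.denominatorℕ (q zero)
  e = suc e-1
  a = ℤ.∣ ℚ.numerator (q zero) ∣

  g′ : Fin (suc n) → ℕ
  g′ zero    = e ℕ.* a
  g′ (suc i) = d ℕ.* g i

-- Used both for a common threshold of finitely many eventual properties and for the value of `k`.
-- The default 0 covers the empty family.
upperBound : ∀ {n} → (Fin n → ℕ) → ℕ
upperBound f = max 0 (tabulate f)

≤upperBound : ∀ {n} (f : Fin n → ℕ) i → f i ℕ.≤ upperBound f
≤upperBound f = tabulate⁻ (xs≤max 0 (tabulate f))

Eventually : (ℕ → Set) → Set
Eventually P = ∃ λ N → ∀ m → N ℕ.≤ m → P m

eventually-∀ : ∀ {n} {P : Fin n → ℕ → Set} →
               (∀ i → Eventually (P i)) → Eventually (λ m → ∀ i → P i m)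
eventually-∀ ev =
  upperBound (proj₁ ∘ ev) ,
  λ m N≤m i → proj₂ (ev i) m (ℕ.≤-trans (≤upperBound (proj₁ ∘ ev) i) N≤m)

-- The order on reals bounds terms only up to `ε`, so `1 ≤ᴿ x` does not make any term at least 1.
-- With `ε` equal to `½` the late terms are still at least `½`; any positive `ε` below 1 would do.
1≤ᴿ⇒eventually-pos : ∀ x → 1ᴿ ≤ᴿ x → Eventually (λ m → 0ℚ ℚ.< seq x m)
1≤ᴿ⇒eventually-pos x 1≤x with N , 1≤x+½ ← 1≤x ½ (ℚ.positive⁻¹ ½) =
  N , λ m N≤m → ℚ.≰⇒> λ x≤0 → ℚ.<-irrefl refl (begin-strict
    1ℚ              ≤⟨ 1≤x+½ m N≤m ⟩
    seq x m ℚ.+ ½   ≤⟨ ℚ.+-monoˡ-≤ ½ x≤0 ⟩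
    0ℚ ℚ.+ ½        <⟨ toWitness {a? = 0ℚ ℚ.+ ½ ℚ.<? 1ℚ} _ ⟩
    1ℚ              ∎)
  where open ℚ.≤-Reasoning

pointwise⇒≤ᴿ : ∀ x y → (∀ m → seq x m ℚ.≤ seq y m) → x ≤ᴿ y
pointwise⇒≤ᴿ x y x≤y ε ε>0 = 0 , λ m _ → begin
  seq x m          ≤⟨ x≤y m ⟩
  seq y m          ≡⟨ ℚ.+-identityʳ (seq y m) ⟨
  seq y m ℚ.+ 0ℚ   ≤⟨ ℚ.+-monoʳ-≤ (seq y m) (ℚ.<⇒≤ ε>0) ⟩
  seq y m ℚ.+ ε    ∎
  where open ℚ.≤-Reasoning

p-q+q≡p : ∀ p q → p ℚ.- q ℚ.+ q ≡ p
p-q+q≡p p q = trans (ℚ.+-assoc p (ℚ.- q) q)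
  (trans (cong (p ℚ.+_) (ℚ.+-inverseˡ q)) (ℚ.+-identityʳ p))

p+q-q≡p : ∀ p q → p ℚ.+ q ℚ.- q ≡ p
p+q-q≡p p q = trans (ℚ.+-assoc p q (ℚ.- q))
  (trans (cong (p ℚ.+_) (ℚ.+-inverseʳ q)) (ℚ.+-identityʳ p))

0<q-p⇒p<q : ∀ {p q} → 0ℚ ℚ.< q ℚ.- p → p ℚ.< q
0<q-p⇒p<q {p} {q} 0<q-p =
  subst₂ ℚ._<_ (ℚ.+-identityˡ p) (p-q+q≡p q p) (ℚ.+-monoˡ-< p 0<q-p)

p+q≤r⇒p≤r-q : ∀ p q {r} → p ℚ.+ q ℚ.≤ r → p ℚ.≤ r ℚ.- q
p+q≤r⇒p≤r-q p q {r} p+q≤r =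
  subst (ℚ._≤ r ℚ.- q) (p+q-q≡p p q) (ℚ.+-monoˡ-≤ (ℚ.- q) p+q≤r)

-- Carries the scaling by `c` from labels to neighbour sums, since `sumᴿ` adds termwise. It is
-- applied with `c` equal to 1 for a given numbering and to the common denominator for a feasible
-- point.
fromℕ-sum : ∀ {A : Set} (f : A → ℝ) {g : A → ℕ} c m →
            (∀ a → fromℕ (g a) ≡ c ℚ.* seq (f a) m) →
            ∀ as → fromℕ (sum (map g as)) ≡ c ℚ.* seq (sumᴿ (map f as)) m
fromℕ-sum f c m eq [] = sym (ℚ.*-zeroʳ c)
fromℕ-sum f {g} c m eq (a ∷ as) = begin
  fromℕ (g a ℕ.+ sum (map g as))
    ≡⟨ fromℕ-homo-+ (g a) (sum (map g as)) ⟩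
  fromℕ (g a) ℚ.+ fromℕ (sum (map g as))
    ≡⟨ cong₂ ℚ._+_ (eq a) (fromℕ-sum f c m eq as) ⟩
  c ℚ.* seq (f a) m ℚ.+ c ℚ.* seq (sumᴿ (map f as)) m
    ≡⟨ ℚ.*-distribˡ-+ c (seq (f a) m) (seq (sumᴿ (map f as)) m) ⟨
  c ℚ.* (seq (f a) m ℚ.+ seq (sumᴿ (map f as)) m) ∎
  where open ≡-Reasoning

module _ (D : DAG) where
  open DAG D

  numbering⇒feasible : (∃ λ f → IsTopologicalAdditiveNumbering D f) →
                       Feasible (numberingLP D)
  numbering⇒feasible (f , isNumbering) = (k , x) , record
    -- Integrality supplies the gap of 1: `S u ℕ.< S v` unfolds to `1 ℕ.+ S u ℕ.≤ S v`.
    { arc-constraint   = λ {u} {v} u⟶v →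
        pointwise⇒≤ᴿ 1ᴿ (Sᴿ v -ᴿ Sᴿ u) λ m → p+q≤r⇒p≤r-q 1ℚ (seq (Sᴿ u) m)
          (subst₂ ℚ._≤_
            (trans (fromℕ-homo-+ 1 (S u)) (cong (1ℚ ℚ.+_) (S≡Sᴿ m u)))
            (S≡Sᴿ m v)
            (fromℕ-mono-≤ (increasing u⟶v)))
    ; upper-constraint = λ v →
        pointwise⇒≤ᴿ 0ᴿ (k -ᴿ x v) λ _ → p+q≤r⇒p≤r-q 0ℚ (fromℕ (f v))
          (subst (ℚ._≤ fromℕ (upperBound f)) (sym (ℚ.+-identityˡ (fromℕ (f v))))
            (fromℕ-mono-≤ (≤upperBound f v)))
    ; lower-constraint = λ v →
        pointwise⇒≤ᴿ 1ᴿ (x v) λ _ → fromℕ-mono-≤ (positive v)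
    }
    where
    open IsTopologicalAdditiveNumbering isNumbering

    k : ℝ
    k = fromℚ (fromℕ (upperBound f))

    x : V → ℝ
    x v = fromℚ (fromℕ (f v))

    Sᴿ : V → ℝ
    Sᴿ v = sumᴿ (map x (N v))

    S≡Sᴿ : ∀ m v → fromℕ (S v) ≡ seq (Sᴿ v) m
    S≡Sᴿ m v = trans
      (fromℕ-sum x 1ℚ m (λ w → sym (ℚ.*-identityˡ (fromℕ (f w)))) (N v))
      (ℚ.*-identityˡ (seq (Sᴿ v) m))

  feasible⇒numbering : Feasible (numberingLP D) →
                       ∃ λ f → IsTopologicalAdditiveNumbering D f
  feasible⇒numbering ((k , x) , constraints) = g , record
    { positive   = λ v → fromℕ-cancel-<
        (subst₂ ℚ._<_ (ℚ.*-zeroʳ d) (sym (g≡dx v)) (ℚ.*-monoʳ-<-pos d (x>0 v)))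
    ; increasing = λ {u} {v} u⟶v → fromℕ-cancel-<
        (subst₂ ℚ._<_ (sym (S≡dSᴿ u)) (sym (S≡dSᴿ v))
          (ℚ.*-monoʳ-<-pos d (Sᴿ-increasing u v u⟶v)))
    }
    where
    open LPConstraints constraints

    Sᴿ : V → ℝ
    Sᴿ v = sumᴿ (map x (N v))

    vertices : Eventually λ m → ∀ v → 0ℚ ℚ.< seq (x v) m
    vertices = eventually-∀ λ v → 1≤ᴿ⇒eventually-pos (x v) (lower-constraint v)

    -- The arc is a premise inside the eventual property, so that `eventually-∀` can range over all
    -- pairs of vertices. The threshold is thus needed before any arc is given, and deciding `u ⟶ v`
    -- provides it.
    arc : ∀ u v → Eventually λ m → u ⟶ v → seq (Sᴿ u) m ℚ.< seq (Sᴿ v) m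
    arc u v with u ⟶? v
    ... | no  ¬u⟶v = 0 , λ _ _ u⟶v → contradiction u⟶v ¬u⟶v
    ... | yes u⟶v
      with N , pos ← 1≤ᴿ⇒eventually-pos (Sᴿ v -ᴿ Sᴿ u) (arc-constraint u⟶v)
      = N , λ m N≤m _ → 0<q-p⇒p<q (pos m N≤m)

    arcs : Eventually λ m → ∀ u v → u ⟶ v → seq (Sᴿ u) m ℚ.< seq (Sᴿ v) m
    arcs = eventually-∀ λ u → eventually-∀ (arc u)

    m : ℕ
    -- Past both thresholds, so the terms at this one index satisfy all the strict inequalities
    -- simultaneously.
    m = proj₁ vertices ℕ.⊔ proj₁ arcs

    x>0 : ∀ v → 0ℚ ℚ.< seq (x v) m
    x>0 = proj₂ vertices m (ℕ.m≤m⊔n _ _)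

    Sᴿ-increasing : ∀ u v → u ⟶ v → seq (Sᴿ u) m ℚ.< seq (Sᴿ v) m
    Sᴿ-increasing = proj₂ arcs m (ℕ.m≤n⊔m (proj₁ vertices) _)

    cleared : ∃₂ λ d-1 (g : V → ℕ) → ∀ v → fromℕ (g v) ≡ fromℕ (suc d-1) ℚ.* seq (x v) m
    cleared = commonDenominator (λ v → seq (x v) m) λ v → ℚ.nonNegative (ℚ.<⇒≤ (x>0 v))

    d : ℚ
    d = fromℕ (suc (proj₁ cleared))

    g : V → ℕ
    g = proj₁ (proj₂ cleared)

    g≡dx : ∀ v → fromℕ (g v) ≡ d ℚ.* seq (x v) m
    g≡dx = proj₂ (proj₂ cleared)

    S≡dSᴿ : ∀ v → fromℕ (sum (map g (N v))) ≡ d ℚ.* seq (Sᴿ v) m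
    S≡dSᴿ v = fromℕ-sum x d m g≡dx (N v)

mainTheorem2 : (D : DAG) → DAG.Connected D →
    (∃ λ f → IsTopologicalAdditiveNumbering D f) ⇔ Feasible (numberingLP D)
mainTheorem2 D _ = mk⇔ (numbering⇒feasible D) (feasible⇒numbering D)
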